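{- Let $\varphi_4:\mathbb{N}\to\mathbb{N}$ be the function defined as follows. The values $\varphi_4(0),\varphi_4(1),\dots,\varphi_4(29)$ are, in order, $$4,5,3,2,0,1,7,6,10,11,\ 8,9,14,15,12,13,18,19,16,17,\ 22,23,20,21,26,27,24,25,28,29,$$ and for $x\ge 30$, $\varphi_4(x)=x\oplus_2 2$. Then, for all nonnegative integers $a,b$, the Halve Nim position $a^1b^14^1$ is a $\mathcal{P}$-position if and only if $b=\varphi_4(a)$. Furthermore, for $a,b\ge 30$, $a^1b^14^1$ is a $\mathcal{P}$-position if and only if $(a+2)\oplus(b+2)=2$.
   Context: $\mathbb{N}$ is the set of nonnegative integers and $\oplus$ denotes bitwise XOR. The $n$-shifted bitwise sum is $x\oplus_n y=\bigl((x+n)\oplus y\bigr)-n$. Halve Nim is a two-player game played on finitely many piles of coins; players alternate moves and a player who cannot move loses. A move is one of: (i) choose one pile and remove at least one coin from it; (ii) halve the game: simultaneously replace every pile of $m$ coins by a pile of $\lfloor m/2\rfloor$ coins. When there are no coins left, no move is available (halving requires at least one coin to be present). A position is a $\mathcal{P}$-position if the player who is not about to move has a winning strategy (equivalently, every move from it leads to an $\mathcal{N}$-position), and an $\mathcal{N}$-position if the player about to move has a winning strategy. $a^1b^1c^1$ denotes the position with three piles of sizes $a$, $b$, $c$ (a pile of size $0$ is an empty pile); in particular $a^1b^14^1$ has piles of sizes $a$, $b$, $4$. -}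

module Defs where

open import Data.Fin using (fromℕ<)
open import Data.List using (List; []; _∷_; map)
open import Data.List.Relation.Unary.Any using (Any)
open import Data.Nat using (ℕ; zero; suc; _+_; _*_; _∸_; _<_; _<?_; _/_; _%_; ⌊_/2⌋)
open import Data.Vec using (Vec; []; _∷_; lookup)
open import Relation.Nullary using (yes; no)

infixl 6 _⊕_ _⊕[_]_

-- XOR of the k lowest binary digits of m and n.
xorDigits : ℕ → ℕ → ℕ → ℕ
xorDigits zero    m n = 0
xorDigits (suc k) m n = (m % 2 + n % 2) % 2 + 2 * xorDigits k (m / 2) (n / 2)

-- Both m and n are less than 2 ^ (m + n), so m + n digits are enough.
_⊕_ : ℕ → ℕ → ℕ
m ⊕ n = xorDigits (m + n) m n

-- x ⊕[ n ] y is the n-shifted bitwise sum of x and y.  The subtraction is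
-- truncated, which differs from integer subtraction only if (x + n) ⊕ y < n;
-- this never happens for n = y = 2 and x ≥ 30, where (x + 2) ⊕ 2 ≥ 32.
_⊕[_]_ : ℕ → ℕ → ℕ → ℕ
x ⊕[ n ] y = ((x + n) ⊕ y) ∸ n

Position : Set
Position = List ℕ

data Remove : Position → Position → Set where
  here  : ∀ {m n ps} → n < m → Remove (m ∷ ps) (n ∷ ps)
  there : ∀ {m ps qs} → Remove ps qs → Remove (m ∷ ps) (m ∷ qs)

infix 4 _⟶_

data _⟶_ : Position → Position → Set where
  remove : ∀ {ps qs} → Remove ps qs → ps ⟶ qs
  halve  : ∀ {ps} → Any (0 <_) ps → ps ⟶ map ⌊_/2⌋ ps

-- The inductive (least fixed point) reading makes an element of either type a
-- well-founded winning strategy: for the player to move in the case of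
-- N-Position, for the other player in the case of P-Position.
mutual
  data P-Position (p : Position) : Set where
    allMoves : (∀ {q} → p ⟶ q → N-Position q) → P-Position p

  data N-Position (p : Position) : Set where
    someMove : ∀ {q} → p ⟶ q → P-Position q → N-Position p

φ₄-table : Vec ℕ 30
φ₄-table =
   4 ∷  5 ∷  3 ∷  2 ∷  0 ∷  1 ∷  7 ∷  6 ∷ 10 ∷ 11 ∷
   8 ∷  9 ∷ 14 ∷ 15 ∷ 12 ∷ 13 ∷ 18 ∷ 19 ∷ 16 ∷ 17 ∷
  22 ∷ 23 ∷ 20 ∷ 21 ∷ 26 ∷ 27 ∷ 24 ∷ 25 ∷ 28 ∷ 29 ∷ []

φ₄ : ℕ → ℕ
φ₄ x with x <? 30
... | yes x<30 = lookup φ₄-table (fromℕ< x<30)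
... | no  _    = x ⊕[ 2 ] 2

{-# OPTIONS --safe #-}
-- For c ≤ 4 the P-positions with piles a, b, c form the graph b = φ c a of an
-- involution.  For a ≥ 30, φ c a with c < 4 is a ⊕ c or a ⊕ (c ⊕ 2), alternating
-- each time a passes a number 28 * 2 ^ i, because halving a P-position must not
-- give a P-position; φ 4 a is a ⊕[ 2 ] 2.  It suffices that these involutions are
-- disjoint, that halving leaves them, and that each (a , b) with b < φ c a and
-- a < φ c b is on a graph with a smaller c or is halved onto a graph.  These
-- facts commute with adding multiples of 8 to large a and b (and of 4 to their
-- halves), so they reduce to finitely many cases, which are evaluated.
module Submission where

open import Defs
open import Data.Empty using (⊥)
open import Data.Fin using (fromℕ<)
open import Data.List using ([]; _∷_; map)
open import Data.List.Relation.Unary.Any using (Any; here; there)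
open import Data.Nat
open import Data.Nat.Divisibility using (divides-refl)
open import Data.Nat.DivMod
open import Data.Nat.ListAction using (sum)
open import Data.Nat.Logarithm using (⌊log₂_⌋; ⌊log₂⌋-mono-≤; ⌊log₂⌊n/2⌋⌋≡⌊log₂n⌋∸1)
open import Data.Nat.Properties
open import Data.Nat.Tactic.RingSolver using (solve-∀)
open import Data.Parity.Base using (Parity; 0ℙ; 1ℙ; _⁻¹)
open import Data.Parity.Properties using (⁻¹-involutive) renaming (_≟_ to _≟ℙ_; suc-homo-⁻¹ to parity-suc)
open import Data.Product using (_×_; _,_; proj₁; proj₂; ∃)
open import Data.Sum as Sum using (_⊎_; inj₁; inj₂)
open import Data.Vec using (Vec; []; _∷_; lookup)
open import Function using (_∘_)
open import Function.Construct.Composition using (_⇔-∘_)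
open import Function.Bundles using (_⇔_; mk⇔; Equivalence)
open import Relation.Binary.Definitions using (tri<; tri≈; tri>)
open import Relation.Binary.PropositionalEquality
open import Relation.Nullary using (Dec; yes; no; ¬?; contradiction)
open import Relation.Nullary.Decidable using (toWitness; map′; _×-dec_; _⊎-dec_; _→-dec_; decidable-stable)

-- Parities, division and halving.

∀ℙ? : ∀ {P : Parity → Set} → (∀ p → Dec (P p)) → Dec (∀ p → P p)
∀ℙ? P? = map′ (λ { (e , o) 0ℙ → e ; (e , o) 1ℙ → o }) (λ h → h 0ℙ , h 1ℙ) (P? 0ℙ ×-dec P? 1ℙ)

[u*n+r]/n : ∀ u r n .{{_ : NonZero n}} → (u * n + r) / n ≡ u + r / n
[u*n+r]/n u r n = trans (+-distrib-/-∣ˡ r (divides-refl u)) (cong (_+ r / n) (m*n/n≡m u n))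

[u*n+r]%n : ∀ u r n .{{_ : NonZero n}} → (u * n + r) % n ≡ r % n
[u*n+r]%n u r n = trans (cong (_% n) (+-comm (u * n) r)) ([m+kn]%n≡m%n r u n)

⌊n*2+r/2⌋ : ∀ n r → ⌊ n * 2 + r /2⌋ ≡ n + ⌊ r /2⌋
⌊n*2+r/2⌋ zero    r = refl
⌊n*2+r/2⌋ (suc n) r = cong suc (⌊n*2+r/2⌋ n r)

n/2≡⌊n/2⌋ : ∀ n → n / 2 ≡ ⌊ n /2⌋
n/2≡⌊n/2⌋ n = begin
  n / 2                      ≡⟨ cong (_/ 2) (m≡m%n+[m/n]*n n 2) ⟩
  (n % 2 + n / 2 * 2) / 2    ≡⟨ cong (_/ 2) (+-comm (n % 2) _) ⟩
  (n / 2 * 2 + n % 2) / 2    ≡⟨ [u*n+r]/n (n / 2) (n % 2) 2 ⟩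
  n / 2 + n % 2 / 2          ≡⟨ cong (n / 2 +_) (toWitness {a? = allUpTo? (λ r → r / 2 ≟ ⌊ r /2⌋) 2} _ (m%n<n n 2)) ⟩
  n / 2 + ⌊ n % 2 /2⌋        ≡⟨ ⌊n*2+r/2⌋ (n / 2) (n % 2) ⟨
  ⌊ n / 2 * 2 + n % 2 /2⌋    ≡⟨ cong ⌊_/2⌋ (+-comm _ (n % 2)) ⟩
  ⌊ n % 2 + n / 2 * 2 /2⌋    ≡⟨ cong ⌊_/2⌋ (m≡m%n+[m/n]*n n 2) ⟨
  ⌊ n /2⌋                    ∎
  where open ≡-Reasoning

-- Bitwise XOR along base-4 digits.

lowDigits : ∀ {u r} → r < 4 → let m = u * 4 + r in
            (m % 2 ≡ r % 2) × (m / 2 % 2 ≡ r / 2 % 2) × (m / 2 / 2 ≡ u)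
lowDigits {u} {r} r<4 = m%2 , m/2%2 , m/2/2
  where
  open ≡-Reasoning
  u*4 : u * 4 + r ≡ u * 2 * 2 + r
  u*4 = cong (_+ r) (sym (*-assoc u 2 2))
  m%2 = trans (cong (_% 2) u*4) ([u*n+r]%n (u * 2) r 2)
  m/2 : (u * 4 + r) / 2 ≡ u * 2 + r / 2
  m/2 = trans (cong (_/ 2) u*4) ([u*n+r]/n (u * 2) r 2)
  m/2%2 = trans (cong (_% 2) m/2) ([u*n+r]%n u (r / 2) 2)
  m/2/2 = begin
    (u * 4 + r) / 2 / 2  ≡⟨ cong (_/ 2) m/2 ⟩
    (u * 2 + r / 2) / 2  ≡⟨ [u*n+r]/n u (r / 2) 2 ⟩
    u + r / 2 / 2        ≡⟨ cong (u +_) (toWitness {a? = allUpTo? (λ r → r / 2 / 2 ≟ 0) 4} _ r<4) ⟩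
    u + 0                ≡⟨ +-identityʳ u ⟩
    u                    ∎

2<4 : 2 < 4
2<4 = s≤s (s≤s (s≤s z≤n))

-- The right-hand side is the shape in which two unfoldings of `xorDigits` leave the two low digits,
-- so that `⊕-split` can match it with `r ⊕ s`.
⊕-low : ∀ {r} → r < 4 → ∀ {s} → s < 4 →
        (r ⊕ s) ≡ (r % 2 + s % 2) % 2 + 2 * ((r / 2 % 2 + s / 2 % 2) % 2)
⊕-low = toWitness {a? = allUpTo? (λ r → allUpTo? (λ s →
  (r ⊕ s) ≟ (r % 2 + s % 2) % 2 + 2 * ((r / 2 % 2 + s / 2 % 2) % 2)) 4) 4} _

⊕-<4 : ∀ {r} → r < 4 → ∀ {s} → s < 4 → (r ⊕ s) < 4
⊕-<4 = toWitness {a? = allUpTo? (λ r → allUpTo? (λ s → (r ⊕ s) <? 4) 4) 4} _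

-- The number of remaining digits k is existential because it depends on the
-- arguments through the fuel of _⊕_; only the bounds on k matter.
⊕-split : ∀ {u v r s} → 1 ≤ u → r < 4 → s < 4 → ∃ λ k → u ≤ k × v ≤ k ×
          ((u * 4 + r) ⊕ (v * 4 + s)) ≡ xorDigits k u v * 4 + (r ⊕ s)
⊕-split {suc u} {v} {r} {s} _ r<4 s<4 = k , u≤k , v≤k , eq
  where
  -- The fuel `suc u * 4 + r + (v * 4 + s)` reduces to four successors around a sum. The two low
  -- digits consume two of them, and `k` is what remains.
  k = suc (suc (u * 4 + r + (v * 4 + s)))
  u≤k : suc u ≤ k
  u≤k = s≤s (m≤n⇒m≤1+n (≤-trans (≤-trans (m≤m*n u 4) (m≤m+n _ r)) (m≤m+n _ _)))
  v≤k : v ≤ k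
  v≤k = m≤n⇒m≤1+n (m≤n⇒m≤1+n (≤-trans (≤-trans (m≤m*n v 4) (m≤m+n _ s)) (m≤n+m _ (u * 4 + r))))
  regroup : ∀ x y d → x + 2 * (y + 2 * d) ≡ d * 4 + (x + 2 * y)
  regroup = solve-∀
  eq : ((suc u * 4 + r) ⊕ (v * 4 + s)) ≡ xorDigits k (suc u) v * 4 + (r ⊕ s)
  eq with m0 , m1 , m2 ← lowDigits {suc u} r<4 | n0 , n1 , n2 ← lowDigits {v} s<4
     rewrite m0 | m1 | m2 | n0 | n1 | n2 | ⊕-low r<4 s<4
     = regroup ((r % 2 + s % 2) % 2) ((r / 2 % 2 + s / 2 % 2) % 2) (xorDigits k (suc u) v)

m/2≤k : ∀ {m k} → m ≤ suc k → m / 2 ≤ k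
m/2≤k {zero}  _    = z≤n
m/2≤k {suc m} m<2+k = m<1+n⇒m≤n (<-≤-trans (m/n<m (suc m) 2 (s≤s (s≤s z≤n))) m<2+k)

xorDigits-0ʳ : ∀ {k m} → m ≤ k → xorDigits k m 0 ≡ m
xorDigits-0ʳ {zero}  z≤n = refl
xorDigits-0ʳ {suc k} {m} m≤1+k = begin
  (m % 2 + 0) % 2 + 2 * xorDigits k (m / 2) 0  ≡⟨ cong₂ (λ x y → x % 2 + 2 * y) (+-identityʳ (m % 2)) (xorDigits-0ʳ (m/2≤k m≤1+k)) ⟩
  m % 2 % 2 + 2 * (m / 2)                      ≡⟨ cong₂ _+_ (m%n%n≡m%n m 2) (*-comm 2 (m / 2)) ⟩
  m % 2 + m / 2 * 2                            ≡⟨ m≡m%n+[m/n]*n m 2 ⟨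
  m                                            ∎
  where open ≡-Reasoning

xorDigits-self : ∀ k m → xorDigits k m m ≡ 0
xorDigits-self zero    m = refl
xorDigits-self (suc k) m = cong₂ (λ x y → x + 2 * y)
  (toWitness {a? = allUpTo? (λ r → (r + r) % 2 ≟ 0) 2} _ (m%n<n m 2)) (xorDigits-self k (m / 2))

xorDigits≡0⇒≡ : ∀ {k m n} → m ≤ k → n ≤ k → xorDigits k m n ≡ 0 → m ≡ n
xorDigits≡0⇒≡ {zero}  z≤n z≤n _ = refl
xorDigits≡0⇒≡ {suc k} {m} {n} m≤1+k n≤1+k eq = begin
  m                  ≡⟨ m≡m%n+[m/n]*n m 2 ⟩
  m % 2 + m / 2 * 2  ≡⟨ cong₂ (λ x y → x + y * 2) m%2≡n%2 m/2≡n/2 ⟩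
  n % 2 + n / 2 * 2  ≡⟨ m≡m%n+[m/n]*n n 2 ⟨
  n                  ∎
  where
  open ≡-Reasoning
  m%2≡n%2 : m % 2 ≡ n % 2
  m%2≡n%2 = toWitness {a? = allUpTo? (λ r → allUpTo? (λ s → ((r + s) % 2 ≟ 0) →-dec (r ≟ s)) 2) 2} _
              (m%n<n m 2) (m%n<n n 2) (m+n≡0⇒m≡0 _ eq)
  m/2≡n/2 : m / 2 ≡ n / 2
  m/2≡n/2 = xorDigits≡0⇒≡ (m/2≤k m≤1+k) (m/2≤k n≤1+k)
              (m+n≡0⇒m≡0 _ (m+n≡0⇒n≡0 ((m % 2 + n % 2) % 2) eq))

⊕-quot : ∀ {y d} → 4 ≤ y → d < 4 → (y ⊕ d) ≡ y / 4 * 4 + (y % 4 ⊕ d)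
⊕-quot {y} {d} 4≤y d<4
  with _ , u≤k , _ , eq ← ⊕-split {v = 0} (/-monoˡ-≤ 4 4≤y) (m%n<n y 4) d<4 = begin
  y ⊕ d                      ≡⟨ cong (_⊕ d) (trans (m≡m%n+[m/n]*n y 4) (+-comm (y % 4) _)) ⟩
  (y / 4 * 4 + y % 4) ⊕ d    ≡⟨ trans eq (cong (λ z → z * 4 + (y % 4 ⊕ d)) (xorDigits-0ʳ u≤k)) ⟩
  y / 4 * 4 + (y % 4 ⊕ d)    ∎
  where open ≡-Reasoning

-- XOR with `d` affects only the last base-4 digit of `y`, and adding `k * 4` leaves that digit
-- alone.
⊕-shift : ∀ k {y d} → 4 ≤ y → d < 4 → ((k * 4 + y) ⊕ d) ≡ k * 4 + (y ⊕ d)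
⊕-shift k {y} {d} 4≤y d<4 = begin
  (k * 4 + y) ⊕ d                                ≡⟨ ⊕-quot (≤-trans 4≤y (m≤n+m y (k * 4))) d<4 ⟩
  (k * 4 + y) / 4 * 4 + ((k * 4 + y) % 4 ⊕ d)    ≡⟨ cong₂ (λ u r → u * 4 + (r ⊕ d)) ([u*n+r]/n k y 4) ([u*n+r]%n k y 4) ⟩
  (k + y / 4) * 4 + (y % 4 ⊕ d)                  ≡⟨ regroup k (y / 4) (y % 4 ⊕ d) ⟩
  k * 4 + (y / 4 * 4 + (y % 4 ⊕ d))              ≡⟨ cong (k * 4 +_) (⊕-quot 4≤y d<4) ⟨
  k * 4 + (y ⊕ d)                                ∎
  where
  open ≡-Reasoning
  regroup : ∀ k u r → (k + u) * 4 + r ≡ k * 4 + (u * 4 + r)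
  regroup = solve-∀

4≤⊕ : ∀ {y d} → 4 ≤ y → d < 4 → 4 ≤ y ⊕ d
4≤⊕ {y} 4≤y d<4 rewrite ⊕-quot 4≤y d<4 = ≤-trans (*-monoˡ-≤ 4 (/-monoˡ-≤ 4 4≤y)) (m≤m+n (y / 4 * 4) _)

-- The involutions `φ c`.

mask : Parity → ℕ
mask 0ℙ = 2
mask 1ℙ = 0

-- The values φ c x for x ≥ 30; only c ≤ 4 is meaningful.
core : Parity → ℕ → ℕ → ℕ
core p 4 x = x ⊕[ 2 ] 2
core p c x = x ⊕ (c ⊕ mask p)

-- Constant for 28 * 2 ^ i ≤ x < 28 * 2 ^ (i + 1), where q = x / 4.  It is opaque
-- because unfolding the well-founded recursion of ⌊log₂_⌋ on open terms blows up.
opaque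
  phase : ℕ → Parity
  phase q = parity ⌊log₂ (q / 7) ⌋

-- The irregular beginning of the involutions. It follows no formula here; the `small-` checks below
-- justify it by evaluation.
table : ℕ → Vec ℕ 30
table 0 =
   0 ∷  2 ∷  1 ∷  3 ∷  4 ∷  5 ∷  8 ∷  9 ∷  6 ∷  7 ∷
  12 ∷ 13 ∷ 10 ∷ 11 ∷ 14 ∷ 15 ∷ 16 ∷ 17 ∷ 18 ∷ 19 ∷
  20 ∷ 21 ∷ 22 ∷ 23 ∷ 24 ∷ 25 ∷ 26 ∷ 27 ∷ 30 ∷ 31 ∷ []
table 1 =
   2 ∷  3 ∷  0 ∷  1 ∷  5 ∷  4 ∷  9 ∷  8 ∷  7 ∷  6 ∷
  13 ∷ 12 ∷ 11 ∷ 10 ∷ 15 ∷ 14 ∷ 17 ∷ 16 ∷ 19 ∷ 18 ∷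
  21 ∷ 20 ∷ 23 ∷ 22 ∷ 25 ∷ 24 ∷ 27 ∷ 26 ∷ 31 ∷ 30 ∷ []
table 2 =
   1 ∷  0 ∷  2 ∷  4 ∷  3 ∷  6 ∷  5 ∷  7 ∷  8 ∷  9 ∷
  10 ∷ 11 ∷ 12 ∷ 13 ∷ 18 ∷ 19 ∷ 20 ∷ 21 ∷ 14 ∷ 15 ∷
  16 ∷ 17 ∷ 26 ∷ 27 ∷ 28 ∷ 29 ∷ 22 ∷ 23 ∷ 24 ∷ 25 ∷ []
table 3 =
   3 ∷  1 ∷  4 ∷  0 ∷  2 ∷  7 ∷  6 ∷  5 ∷  9 ∷  8 ∷
  11 ∷ 10 ∷ 13 ∷ 12 ∷ 19 ∷ 18 ∷ 21 ∷ 20 ∷ 15 ∷ 14 ∷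
  17 ∷ 16 ∷ 27 ∷ 26 ∷ 29 ∷ 28 ∷ 23 ∷ 22 ∷ 25 ∷ 24 ∷ []
table _ = φ₄-table

φ : ℕ → ℕ → ℕ
φ c x with x <? 30
... | yes x<30 = lookup (table c) (fromℕ< x<30)
... | no  _    = core (phase (x / 4)) c x

φ-4 : ∀ x → φ 4 x ≡ φ₄ x
φ-4 x with x <? 30
... | yes _ = refl
... | no  _ = refl

φ-core : ∀ c {x} → 30 ≤ x → φ c x ≡ core (phase (x / 4)) c x
φ-core c {x} 30≤x with x <? 30
... | yes x<30 = contradiction x<30 (≤⇒≯ 30≤x)
... | no  _    = refl

-- Translating the involutions by multiples of 4 and 8.

⊕-mask<4 : ∀ p {c} → c < 4 → (c ⊕ mask p) < 4
⊕-mask<4 = toWitness {a? = ∀ℙ? λ p → allUpTo? (λ c → (c ⊕ mask p) <? 4) 4} _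

core-shift : ∀ p c k {y} → c < 5 → 4 ≤ y → core p c (k * 4 + y) ≡ k * 4 + core p c y
core-shift p 0 k _ 4≤y = ⊕-shift k 4≤y (⊕-mask<4 p (s≤s z≤n))
core-shift p 1 k _ 4≤y = ⊕-shift k 4≤y (⊕-mask<4 p (s≤s (s≤s z≤n)))
core-shift p 2 k _ 4≤y = ⊕-shift k 4≤y (⊕-mask<4 p (s≤s (s≤s (s≤s z≤n))))
core-shift p 3 k _ 4≤y = ⊕-shift k 4≤y (⊕-mask<4 p (s≤s (s≤s (s≤s (s≤s z≤n)))))
core-shift p 4 k {y} _ 4≤y = begin
  ((k * 4 + y + 2) ⊕ 2) ∸ 2    ≡⟨ cong (λ z → (z ⊕ 2) ∸ 2) (+-assoc (k * 4) y 2) ⟩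
  ((k * 4 + (y + 2)) ⊕ 2) ∸ 2  ≡⟨ cong (_∸ 2) (⊕-shift k 4≤y+2 2<4) ⟩
  (k * 4 + ((y + 2) ⊕ 2)) ∸ 2  ≡⟨ +-∸-assoc (k * 4) (≤-trans (m≤n+m 2 2) (4≤⊕ 4≤y+2 2<4)) ⟩
  k * 4 + (((y + 2) ⊕ 2) ∸ 2)  ∎
  where
  open ≡-Reasoning
  4≤y+2 = ≤-trans 4≤y (m≤m+n y 2)
core-shift p (suc (suc (suc (suc (suc _))))) k (s≤s (s≤s (s≤s (s≤s (s≤s ()))))) _

opaque
  unfolding phase

  -- Dividing by 7 commutes with halving, so halving `q` lowers the logarithm of `q / 7` by one;
  -- `14 ≤ q` makes that logarithm positive.
  phase-half : ∀ {q} → 14 ≤ q → phase q ≡ phase ⌊ q /2⌋ ⁻¹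
  phase-half {q} 14≤q = begin
    parity ⌊log₂ (q / 7) ⌋                    ≡⟨ flip 1≤log ⟩
    parity (⌊log₂ (q / 7) ⌋ ∸ 1) ⁻¹           ≡⟨ cong (λ z → parity z ⁻¹) (⌊log₂⌊n/2⌋⌋≡⌊log₂n⌋∸1 (q / 7)) ⟨
    parity ⌊log₂ ⌊ q / 7 /2⌋ ⌋ ⁻¹             ≡⟨ cong (λ z → parity ⌊log₂ z ⌋ ⁻¹) swap ⟩
    parity ⌊log₂ (⌊ q /2⌋ / 7) ⌋ ⁻¹           ∎
    where
    open ≡-Reasoning
    flip : ∀ {n} → 1 ≤ n → parity n ≡ parity (n ∸ 1) ⁻¹
    flip {suc n} _ = sym (trans (cong _⁻¹ (sym (parity-suc n))) (⁻¹-involutive (parity (suc n))))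
    1≤log : 1 ≤ ⌊log₂ (q / 7) ⌋
    1≤log = ⌊log₂⌋-mono-≤ (/-monoˡ-≤ 7 14≤q)
    swap : ⌊ q / 7 /2⌋ ≡ ⌊ q /2⌋ / 7
    swap = begin
      ⌊ q / 7 /2⌋    ≡⟨ n/2≡⌊n/2⌋ (q / 7) ⟨
      q / 7 / 2      ≡⟨ m/n/o≡m/[n*o] q 7 2 ⟩
      q / 14         ≡⟨ m/n/o≡m/[n*o] q 2 7 ⟨
      q / 2 / 7      ≡⟨ cong (_/ 7) (n/2≡⌊n/2⌋ q) ⟩
      ⌊ q /2⌋ / 7    ∎

-- `core` commutes with the translation, but the phase may change. It stays symbolic, and the finite
-- checks quantify over parities instead.
φ-shift : ∀ c k {y} → c < 5 → 4 ≤ y → 30 ≤ k * 4 + y →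
          φ c (k * 4 + y) ≡ k * 4 + core (phase (k + y / 4)) c y
φ-shift c k {y} c<5 4≤y 30≤ = begin
  φ c (k * 4 + y)                                   ≡⟨ φ-core c 30≤ ⟩
  core (phase ((k * 4 + y) / 4)) c (k * 4 + y)      ≡⟨ core-shift _ c k c<5 4≤y ⟩
  k * 4 + core (phase ((k * 4 + y) / 4)) c y        ≡⟨ cong (λ q → k * 4 + core (phase q) c y) ([u*n+r]/n k y 4) ⟩
  k * 4 + core (phase (k + y / 4)) c y              ∎
  where open ≡-Reasoning

φ-block : ∀ c {j y} → c < 5 → 7 ≤ j → 4 ≤ y →
          φ c (j * 8 + y) ≡ j * 8 + core (phase (j * 2 + y / 4)) c y
φ-block c {j} {y} c<5 7≤j 4≤y rewrite sym (*-assoc j 2 4) = φ-shift c (j * 2) c<5 4≤y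
  (≤-trans (m≤m+n 30 26) (≤-trans (*-monoˡ-≤ 4 (*-monoˡ-≤ 2 7≤j)) (m≤m+n _ y)))

-- The quotients by 4 in this block of eight are `2 * suc j` and its successor, and both halve to
-- `suc j`. Hence one parity governs the block and its halves.
phase-upper : ∀ {j r} → 7 ≤ j → r < 8 → phase (j * 2 + (8 + r) / 4) ≡ phase (suc j) ⁻¹
phase-upper {j} {r} 7≤j r<8 = trans
  (phase-half (≤-trans (*-monoˡ-≤ 2 7≤j) (m≤m+n (j * 2) _)))
  (cong (λ q → phase q ⁻¹) (begin
    ⌊ j * 2 + (8 + r) / 4 /2⌋  ≡⟨ ⌊n*2+r/2⌋ j ((8 + r) / 4) ⟩
    j + ⌊ (8 + r) / 4 /2⌋      ≡⟨ cong (j +_) (toWitness {a? = allUpTo? (λ r → ⌊ (8 + r) / 4 /2⌋ ≟ 1) 8} _ r<8) ⟩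
    j + 1                      ≡⟨ +-comm j 1 ⟩
    suc j                      ∎))
  where open ≡-Reasoning

φ-upper : ∀ c {j r} → c < 5 → 7 ≤ j → r < 8 →
          φ c (j * 8 + (8 + r)) ≡ j * 8 + core (phase (suc j) ⁻¹) c (8 + r)
φ-upper c {j} {r} c<5 7≤j r<8 = trans (φ-block c c<5 7≤j (m≤m+n 4 (4 + r)))
  (cong (λ p → j * 8 + core p c (8 + r)) (phase-upper 7≤j r<8))

⌊j*8+y/2⌋ : ∀ j y → ⌊ j * 8 + y /2⌋ ≡ j * 4 + ⌊ y /2⌋
⌊j*8+y/2⌋ j y rewrite sym (*-assoc j 4 2) = ⌊n*2+r/2⌋ (j * 4) y

φ-lower : ∀ c {j r} → c < 5 → 7 ≤ j → r < 8 →
          φ c ⌊ j * 8 + (8 + r) /2⌋ ≡ j * 4 + core (phase (suc j)) c ⌊ 8 + r /2⌋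
φ-lower c {j} {r} c<5 7≤j r<8 rewrite ⌊j*8+y/2⌋ j (8 + r) =
  trans (φ-shift c j c<5 (m≤m+n 4 _) 30≤)
        (cong (λ q → j * 4 + core (phase q) c ⌊ 8 + r /2⌋) (trans (cong (j +_)
          (toWitness {a? = allUpTo? (λ r → ⌊ 8 + r /2⌋ / 4 ≟ 1) 8} _ r<8)) (+-comm j 1)))
  where
  30≤ : 30 ≤ j * 4 + ⌊ 8 + r /2⌋
  30≤ = ≤-trans (m≤m+n 30 2) (+-mono-≤ (*-monoˡ-≤ 4 7≤j) (m≤m+n 4 _))

-- The offset 8 leaves room below: images and competitors of such a number still have the form
-- `j * 8 + y` with `4 ≤ y`. The bound on `j` puts the halves at 32 or more, beyond the tables.
data Large : ℕ → Set where
  large : ∀ {j r} → 7 ≤ j → r < 8 → Large (j * 8 + (8 + r))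

large? : ∀ {x} → 64 ≤ x → Large x
large? {x} 64≤x with x / 8 | /-monoˡ-≤ 8 64≤x | m≡m%n+[m/n]*n x 8
... | suc j | s≤s 7≤j | x≡ = subst Large (sym (trans x≡ (regroup (x % 8) j))) (large 7≤j (m%n<n x 8))
  where
  regroup : ∀ r j → r + suc j * 8 ≡ j * 8 + (8 + r)
  regroup = solve-∀

splitAt64 : ∀ {P : ℕ → Set} → (∀ {x} → x < 64 → P x) → (∀ {x} → Large x → P x) → ∀ x → P x
splitAt64 small big x with x <? 64
... | yes x<64 = small x<64
... | no  x≮64 = big (large? (≮⇒≥ x≮64))

-- Finite checks by evaluation.

core-window : ∀ p {c} → c < 5 → ∀ {r} → r < 8 → 4 ≤ core p c (8 + r) × core p c (8 + r) ≤ 8 + r + 5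
core-window = toWitness {a? = ∀ℙ? λ p → allUpTo? (λ c → allUpTo? (λ r →
  (4 ≤? core p c (8 + r)) ×-dec (core p c (8 + r) ≤? 8 + r + 5)) 8) 5} _

-- For `c < 4` the image stays in the same block of four, so the phases agree. For `c = 4` it leaves
-- the block, but there `core` is the same in both phases.
core-involutive : ∀ p p′ {c} → c < 5 → ∀ {r} → r < 8 →
                  (core p c (8 + r) / 4 ≡ (8 + r) / 4 → p′ ≡ p) → core p′ c (core p c (8 + r)) ≡ 8 + r
core-involutive = toWitness {a? = ∀ℙ? λ p → ∀ℙ? λ p′ → allUpTo? (λ c → allUpTo? (λ r →
  ((core p c (8 + r) / 4 ≟ (8 + r) / 4) →-dec (p′ ≟ℙ p)) →-dec (core p′ c (core p c (8 + r)) ≟ 8 + r)) 8) 5} _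

-- Below 4, different `c` give XORs with different numbers and stay in the block of four; `c = 4`
-- always leaves it.
core-distinct : ∀ p {c} → c < 5 → ∀ {d} → d < c → ∀ {r} → r < 8 → core p d (8 + r) ≢ core p c (8 + r)
core-distinct = toWitness {a? = ∀ℙ? λ p → allUpTo? (λ c → allUpTo? (λ d → allUpTo? (λ r →
  ¬? (core p d (8 + r) ≟ core p c (8 + r))) 8) c) 5} _

-- For `c < 4` both sides XOR `⌊ 8 + r /2⌋` with numbers that differ because the masks contribute 0
-- against 2, or 1 against 0. For `c = 4` the left side is off by 1, the right side by 0 or 2.
core-halve : ∀ p {c} → c < 5 → ∀ {r} → r < 8 →
             ⌊ core (p ⁻¹) c (8 + r) /2⌋ ≢ core p ⌊ c /2⌋ ⌊ 8 + r /2⌋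
core-halve = toWitness {a? = ∀ℙ? λ p → allUpTo? (λ c → allUpTo? (λ r →
  ¬? (⌊ core (p ⁻¹) c (8 + r) /2⌋ ≟ core p ⌊ c /2⌋ ⌊ 8 + r /2⌋)) 8) 5} _

-- The two inequalities put both numbers in one block of four, so they are related by `core` for
-- some `d < 4` with `d ≢ c`. If `d > c`, they force mask 2 and `c < 2 ≤ d`; then the halves
-- coincide, as the opposite phase requires for `⌊ c /2⌋ ≡ 0`.
core-cover : ∀ p p′ {c} → c < 5 → ∀ {r} → r < 8 → ∀ {s} → s < 16 →
             ((4 + s) / 4 ≡ (8 + r) / 4 → p′ ≡ p ⁻¹) →
             4 + s < core (p ⁻¹) c (8 + r) → 8 + r < core p′ c (4 + s) →
             (∃ λ d → d < c × 4 + s ≡ core (p ⁻¹) d (8 + r)) ⊎ ⌊ 4 + s /2⌋ ≡ core p ⌊ c /2⌋ ⌊ 8 + r /2⌋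
core-cover = toWitness {a? = ∀ℙ? λ p → ∀ℙ? λ p′ → allUpTo? (λ c → allUpTo? (λ r → allUpTo? (λ s →
  (((4 + s) / 4 ≟ (8 + r) / 4) →-dec (p′ ≟ℙ p ⁻¹)) →-dec
  ((4 + s <? core (p ⁻¹) c (8 + r)) →-dec ((8 + r <? core p′ c (4 + s)) →-dec
  (anyUpTo? (λ d → 4 + s ≟ core (p ⁻¹) d (8 + r)) c ⊎-dec (⌊ 4 + s /2⌋ ≟ core p ⌊ c /2⌋ ⌊ 8 + r /2⌋))))) 16) 8) 5} _

⌊c/2⌋<5 : ∀ {c} → c < 5 → ⌊ c /2⌋ < 5
⌊c/2⌋<5 {c} = ≤-<-trans (⌊n/2⌋≤n c)

Coverable : ℕ → ℕ → ℕ → Set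
Coverable c x y = (∃ λ d → d < c × y ≡ φ d x) ⊎ ⌊ y /2⌋ ≡ φ ⌊ c /2⌋ ⌊ x /2⌋

opaque
  unfolding phase

  -- The constant 5 is attained in the tables: row 3 pairs 14 with 19.
  small-bound : ∀ {c} → c < 5 → ∀ {x} → x < 64 → φ c x ≤ x + 5
  small-bound = toWitness {a? = allUpTo? (λ c → allUpTo? (λ x → φ c x ≤? x + 5) 64) 5} _

  small-involutive : ∀ {c} → c < 5 → ∀ {x} → x < 64 → φ c (φ c x) ≡ x
  small-involutive = toWitness {a? = allUpTo? (λ c → allUpTo? (λ x → φ c (φ c x) ≟ x) 64) 5} _

  small-distinct : ∀ {c} → c < 5 → ∀ {d} → d < c → ∀ {x} → x < 64 → φ d x ≢ φ c x
  small-distinct = toWitness {a? = allUpTo? (λ c → allUpTo? (λ d → allUpTo? (λ x →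
    ¬? (φ d x ≟ φ c x)) 64) c) 5} _

  small-halve : ∀ {c} → c < 5 → ∀ {x} → x < 64 → 0 < x + c → ⌊ φ c x /2⌋ ≢ φ ⌊ c /2⌋ ⌊ x /2⌋
  small-halve = toWitness {a? = allUpTo? (λ c → allUpTo? (λ x →
    (0 <? x + c) →-dec ¬? (⌊ φ c x /2⌋ ≟ φ ⌊ c /2⌋ ⌊ x /2⌋)) 64) 5} _

  small-cover : ∀ {c} → c < 5 → ∀ {x} → x < 64 → ∀ {y} → y < φ c x → x < φ c y → Coverable c x y
  small-cover = toWitness {a? = allUpTo? (λ c → allUpTo? (λ x → allUpTo? (λ y → (x <? φ c y) →-dec
    (anyUpTo? (λ d → y ≟ φ d x) c ⊎-dec (⌊ y /2⌋ ≟ φ ⌊ c /2⌋ ⌊ x /2⌋))) (φ c x)) 64) 5} _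

-- Properties of the involutions at all arguments.

φ-bound : ∀ {c} → c < 5 → ∀ x → φ c x ≤ x + 5
φ-bound {c} c<5 = splitAt64 (small-bound c<5) big
  where
  big : ∀ {x} → Large x → φ c x ≤ x + 5
  big (large {j} {r} 7≤j r<8) rewrite φ-upper c c<5 7≤j r<8 | +-assoc (j * 8) (8 + r) 5 =
    +-monoʳ-≤ (j * 8) (proj₂ (core-window (phase (suc j) ⁻¹) c<5 r<8))

φ-involutive : ∀ {c} → c < 5 → ∀ x → φ c (φ c x) ≡ x
φ-involutive {c} c<5 = splitAt64 (small-involutive c<5) big
  where
  big : ∀ {x} → Large x → φ c (φ c x) ≡ x
  big (large {j} {r} 7≤j r<8) = begin
    φ c (φ c (j * 8 + (8 + r)))  ≡⟨ cong (φ c) (φ-block c c<5 7≤j (m≤m+n 4 _)) ⟩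
    φ c (j * 8 + y)              ≡⟨ φ-block c c<5 7≤j (proj₁ (core-window p c<5 r<8)) ⟩
    j * 8 + core p′ c y          ≡⟨ cong (j * 8 +_) (core-involutive p p′ c<5 r<8 (cong (λ q → phase (j * 2 + q)))) ⟩
    j * 8 + (8 + r)              ∎
    where
    open ≡-Reasoning
    p = phase (j * 2 + (8 + r) / 4)
    y = core p c (8 + r)
    p′ = phase (j * 2 + y / 4)

φ-distinct : ∀ {c} → c < 5 → ∀ {d} → d < c → ∀ x → φ d x ≢ φ c x
φ-distinct {c} c<5 {d} d<c = splitAt64 (small-distinct c<5 d<c) big
  where
  big : ∀ {x} → Large x → φ d x ≢ φ c x
  big (large {j} 7≤j r<8)
    rewrite φ-upper c c<5 7≤j r<8 | φ-upper d (<-trans d<c c<5) 7≤j r<8 =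
    core-distinct (phase (suc j) ⁻¹) c<5 d<c r<8 ∘ +-cancelˡ-≡ (j * 8) _ _

φ-halve : ∀ {c} → c < 5 → ∀ x → 0 < x + c → ⌊ φ c x /2⌋ ≢ φ ⌊ c /2⌋ ⌊ x /2⌋
φ-halve {c} c<5 = splitAt64 (small-halve c<5) (λ l _ → big l)
  where
  big : ∀ {x} → Large x → ⌊ φ c x /2⌋ ≢ φ ⌊ c /2⌋ ⌊ x /2⌋
  big (large {j} {r} 7≤j r<8)
    rewrite φ-upper c c<5 7≤j r<8 | φ-lower ⌊ c /2⌋ (⌊c/2⌋<5 c<5) 7≤j r<8
          | ⌊j*8+y/2⌋ j (core (phase (suc j) ⁻¹) c (8 + r)) =
    core-halve (phase (suc j)) c<5 r<8 ∘ +-cancelˡ-≡ (j * 4) _ _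

φ-cover : ∀ {c} → c < 5 → ∀ x {y} → y < φ c x → x < φ c y → Coverable c x y
φ-cover {c} c<5 = splitAt64 (small-cover c<5) big
  where
  big : ∀ {x} → Large x → ∀ {y} → y < φ c x → x < φ c y → Coverable c x y
  big (large {j} {r} 7≤j r<8) {y} y<φx x<φy = subst (Coverable c (j * 8 + (8 + r))) (sym y≡) (covered {y ∸ (j * 8 + 4)} s<16
    (subst₂ _<_ y≡ (φ-upper c c<5 7≤j r<8) y<φx)
    (subst (λ z → _ < z) (trans (cong (φ c) y≡) (φ-block c c<5 7≤j (m≤m+n 4 _))) x<φy))
    where
    open ≤-Reasoning
    -- `x < φ c y ≤ y + 5` bounds `y` from below and `y < φ c x ≤ x + 5` from above, which leaves
    -- the 16 numbers starting at `j * 8 + 4`.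
    lower : j * 8 + 4 ≤ y
    lower = +-cancelʳ-≤ 5 _ _ (begin
      j * 8 + 4 + 5          ≡⟨ +-assoc (j * 8) 4 5 ⟩
      j * 8 + 9              ≤⟨ +-monoʳ-≤ (j * 8) (m≤m+n 9 r) ⟩
      j * 8 + (9 + r)        ≡⟨ +-suc (j * 8) (8 + r) ⟩
      suc (j * 8 + (8 + r))  ≤⟨ x<φy ⟩
      φ c y                  ≤⟨ φ-bound c<5 y ⟩
      y + 5                  ∎)
    y≡ : y ≡ j * 8 + (4 + (y ∸ (j * 8 + 4)))
    y≡ = trans (sym (m+[n∸m]≡n lower)) (+-assoc (j * 8) 4 _)
    s<16 : y ∸ (j * 8 + 4) < 16
    s<16 = +-cancelˡ-< (j * 8 + 4) _ _ (begin-strict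
      j * 8 + 4 + (y ∸ (j * 8 + 4))  ≡⟨ m+[n∸m]≡n lower ⟩
      y                              <⟨ y<φx ⟩
      φ c (j * 8 + (8 + r))          ≤⟨ φ-bound c<5 (j * 8 + (8 + r)) ⟩
      j * 8 + (8 + r) + 5            ≡⟨ trans (+-assoc (j * 8) (8 + r) 5) (cong (j * 8 +_) (+-comm (8 + r) 5)) ⟩
      j * 8 + (13 + r)               ≤⟨ +-monoʳ-≤ (j * 8) (+-monoʳ-≤ 13 (m<1+n⇒m≤n r<8)) ⟩
      j * 8 + 20                     ≡⟨ +-assoc (j * 8) 4 16 ⟨
      j * 8 + 4 + 16                 ∎)
    covered : ∀ {s} → s < 16 → j * 8 + (4 + s) < j * 8 + core (phase (suc j) ⁻¹) c (8 + r) →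
              j * 8 + (8 + r) < j * 8 + core (phase (j * 2 + (4 + s) / 4)) c (4 + s) →
              Coverable c (j * 8 + (8 + r)) (j * 8 + (4 + s))
    covered {s} s<16 y<φx x<φy = Sum.map
      (λ { (d , d<c , eq) → d , d<c , trans (cong (j * 8 +_) eq) (sym (φ-upper d (<-trans d<c c<5) 7≤j r<8)) })
      (λ eq → trans (⌊j*8+y/2⌋ j (4 + s)) (trans (cong (j * 4 +_) eq) (sym (φ-lower ⌊ c /2⌋ (⌊c/2⌋<5 c<5) 7≤j r<8))))
      (core-cover (phase (suc j)) (phase (j * 2 + (4 + s) / 4)) c<5 r<8 s<16
        -- In the same block of four `y` has the phase of `x`, opposite to the phase of the halves.
        (λ q≡ → trans (cong (λ q → phase (j * 2 + q)) q≡) (phase-upper 7≤j r<8))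
        (+-cancelˡ-< (j * 8) _ _ y<φx) (+-cancelˡ-< (j * 8) _ _ x<φy))

-- Solving the game.

sum-remove : ∀ {ps qs} → Remove ps qs → sum qs < sum ps
sum-remove (here {ps = ps} n<m) = +-monoˡ-< (sum ps) n<m
sum-remove (there {m} r)        = +-monoʳ-< m (sum-remove r)

sum-halve-≤ : ∀ ps → sum (map ⌊_/2⌋ ps) ≤ sum ps
sum-halve-≤ []       = z≤n
sum-halve-≤ (m ∷ ps) = +-mono-≤ (⌊n/2⌋≤n m) (sum-halve-≤ ps)

sum-halve-< : ∀ {ps} → Any (0 <_) ps → sum (map ⌊_/2⌋ ps) < sum ps
sum-halve-< {suc m ∷ ps} (here _)  = +-mono-<-≤ (⌊n/2⌋<n m) (sum-halve-≤ ps)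
sum-halve-< {m ∷ ps}     (there h) = +-mono-≤-< (⌊n/2⌋≤n m) (sum-halve-< h)

-- The total number of coins is the measure for the induction in `solved`.
sum-move : ∀ {p q} → p ⟶ q → sum q < sum p
sum-move (remove r) = sum-remove r
sum-move (halve h)  = sum-halve-< h

-- Playing the two winning strategies against each other descends structurally, so the play cannot
-- end.
P∧N⇒⊥ : ∀ {p} → P-Position p → N-Position p → ⊥
P∧N⇒⊥ (allMoves f) (someMove p⟶q Pq) = P∧N⇒⊥ Pq (f p⟶q)

φ-swap : ∀ {c} → c < 5 → ∀ {a b} → b ≡ φ c a → a ≡ φ c b
φ-swap c<5 {a} refl = sym (φ-involutive c<5 a)

-- Since `φ 0 0` is 0, the case `a = c = 0` is the empty game, which cannot be halved. `φ-halve`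
-- fails there.
φ-nonzero : ∀ {a c} → Any (0 <_) (a ∷ φ c a ∷ c ∷ []) → 0 < a + c
φ-nonzero {suc a}         _                        = z<s
φ-nonzero {zero} {suc c}  _                        = z<s
φ-nonzero {zero} {zero}   (there (there (here ())))

someNonzero : ∀ {a b c} → b ≢ φ c a → Any (0 <_) (a ∷ b ∷ c ∷ [])
someNonzero {suc a}                _   = here z<s
someNonzero {zero} {suc b}         _   = there (here z<s)
someNonzero {zero} {zero} {suc c}  _   = there (there (here z<s))
someNonzero {zero} {zero} {zero}   b≢φ = contradiction refl b≢φ

-- The two halves go through one induction, each using the other at smaller positions.
Solved : ℕ → ℕ → ℕ → Set
Solved a b c = (b ≡ φ c a → P-Position (a ∷ b ∷ c ∷ [])) × (b ≢ φ c a → N-Position (a ∷ b ∷ c ∷ []))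

solved-step : ∀ {a b c} → c < 5 →
  (∀ {a′ b′ c′} → (a ∷ b ∷ c ∷ []) ⟶ (a′ ∷ b′ ∷ c′ ∷ []) → c′ < 5 → Solved a′ b′ c′) →
  Solved a b c
solved-step {a} {b} {c} c<5 ih = (λ b≡φ → allMoves (losing b≡φ)) , winning
  where
  losing : b ≡ φ c a → ∀ {q} → (a ∷ b ∷ c ∷ []) ⟶ q → N-Position q
  losing b≡φ m@(remove (here a′<a)) = proj₂ (ih m c<5)
    (λ b≡φ′ → <⇒≢ a′<a (trans (φ-swap c<5 b≡φ′) (sym (φ-swap c<5 b≡φ))))
  losing b≡φ m@(remove (there (here b′<b))) = proj₂ (ih m c<5)
    (λ b′≡φ → <⇒≢ b′<b (trans b′≡φ (sym b≡φ)))
  losing b≡φ m@(remove (there (there (here d<c)))) = proj₂ (ih m (<-trans d<c c<5))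
    (λ b≡φ′ → φ-distinct c<5 d<c a (trans (sym b≡φ′) b≡φ))
  losing refl m@(halve h) = proj₂ (ih m (⌊c/2⌋<5 c<5)) (φ-halve c<5 a (φ-nonzero h))

  move : ∀ {a′ b′ c′} → (a ∷ b ∷ c ∷ []) ⟶ (a′ ∷ b′ ∷ c′ ∷ []) → c′ < 5 → b′ ≡ φ c′ a′ →
         N-Position (a ∷ b ∷ c ∷ [])
  move m c′<5 b′≡φ = someMove m (proj₁ (ih m c′<5) b′≡φ)

  winning : b ≢ φ c a → N-Position (a ∷ b ∷ c ∷ [])
  -- A pile above its partner is lowered onto the graph of `φ c`. When both lie below their
  -- partners, `φ-cover` supplies a removal from `c` or a halving.
  winning b≢φ with <-cmp b (φ c a) | <-cmp a (φ c b)
  ... | tri> _ _ φa<b | _             = move (remove (there (here φa<b))) c<5 refl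
  ... | tri≈ _ b≡φ _  | _             = contradiction b≡φ b≢φ
  ... | tri< _ _ _    | tri> _ _ φb<a = move (remove (here φb<a)) c<5 (sym (φ-involutive c<5 b))
  ... | tri< _ _ _    | tri≈ _ a≡φ _  = contradiction (φ-swap c<5 a≡φ) b≢φ
  ... | tri< b<φa _ _ | tri< a<φb _ _ with φ-cover c<5 a b<φa a<φb
  ...   | inj₁ (d , d<c , b≡φ) = move (remove (there (there (here d<c)))) (<-trans d<c c<5) b≡φ
  ...   | inj₂ half≡           = move (halve (someNonzero b≢φ)) (⌊c/2⌋<5 c<5) half≡

solved : ∀ n {a b c} → sum (a ∷ b ∷ c ∷ []) < n → c < 5 → Solved a b c
solved (suc n) (s≤s s≤n) c<5 = solved-step c<5 (λ m → solved n (<-≤-trans (sum-move m) s≤n))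

P⇔φ : ∀ {a b c} → c < 5 → P-Position (a ∷ b ∷ c ∷ []) ⇔ b ≡ φ c a
P⇔φ {a} {b} {c} c<5 with P-if , N-if ← solved _ {a} {b} ≤-refl c<5 =
  mk⇔ (λ P → decidable-stable (b ≟ φ c a) (P∧N⇒⊥ P ∘ N-if)) P-if

-- The XOR criterion for large piles.

⊕≡2⇔ : ∀ {m n} → 4 ≤ m → 4 ≤ n → m ⊕ n ≡ 2 ⇔ n ≡ m ⊕ 2
⊕≡2⇔ {m} {n} 4≤m 4≤n = mk⇔ to from
  where
  open ≡-Reasoning
  digits : ∀ x → x ≡ x / 4 * 4 + x % 4
  digits x = trans (m≡m%n+[m/n]*n x 4) (+-comm (x % 4) _)
  low≡2 : ∀ {r} → r < 4 → ∀ {s} → s < 4 → r ⊕ s ≡ 2 → s ≡ r ⊕ 2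
  low≡2 = toWitness {a? = allUpTo? (λ r → allUpTo? (λ s → (r ⊕ s ≟ 2) →-dec (s ≟ r ⊕ 2)) 4) 4} _
  low-2 : ∀ {r} → r < 4 → r ⊕ (r ⊕ 2) ≡ 2
  low-2 = toWitness {a? = allUpTo? (λ r → r ⊕ (r ⊕ 2) ≟ 2) 4} _

  to : m ⊕ n ≡ 2 → n ≡ m ⊕ 2
  to eq with k , u≤k , v≤k , split ← ⊕-split {v = n / 4} (/-monoˡ-≤ 4 4≤m) (m%n<n m 4) (m%n<n n 4) = begin
    n                          ≡⟨ digits n ⟩
    n / 4 * 4 + n % 4          ≡⟨ cong₂ (λ v s → v * 4 + s) (sym (xorDigits≡0⇒≡ u≤k v≤k X≡0)) (low≡2 (m%n<n m 4) (m%n<n n 4) w≡2) ⟩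
    m / 4 * 4 + (m % 4 ⊕ 2)    ≡⟨ ⊕-quot 4≤m 2<4 ⟨
    m ⊕ 2                      ∎
    where
    X = xorDigits k (m / 4) (n / 4)
    w = m % 4 ⊕ n % 4
    X*4+w≡2 : X * 4 + w ≡ 2
    X*4+w≡2 = trans (sym split) (trans (sym (cong₂ _⊕_ (digits m) (digits n))) eq)
    X≡0 : X ≡ 0
    -- Dividing `X * 4 + w ≡ 2` by 4 gives `X + w / 4 ≡ 0`.
    X≡0 = m+n≡0⇒m≡0 X (trans (sym ([u*n+r]/n X w 4)) (cong (_/ 4) X*4+w≡2))
    w≡2 : w ≡ 2
    w≡2 = subst (λ z → z * 4 + w ≡ 2) X≡0 X*4+w≡2

  from : n ≡ m ⊕ 2 → m ⊕ n ≡ 2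
  from refl with k , _ , _ , split ← ⊕-split {v = m / 4} (/-monoˡ-≤ 4 4≤m) (m%n<n m 4) (⊕-<4 (m%n<n m 4) 2<4) = begin
    m ⊕ (m ⊕ 2)                                            ≡⟨ cong₂ _⊕_ (digits m) (⊕-quot 4≤m 2<4) ⟩
    (m / 4 * 4 + m % 4) ⊕ (m / 4 * 4 + (m % 4 ⊕ 2))        ≡⟨ split ⟩
    xorDigits k (m / 4) (m / 4) * 4 + (m % 4 ⊕ (m % 4 ⊕ 2))  ≡⟨ cong₂ (λ x y → x * 4 + y) (xorDigits-self k (m / 4)) (low-2 (m%n<n m 4)) ⟩
    2                                                      ∎

≡φ₄⇔ : ∀ {a b} → a ≥ 30 → b ≥ 30 → b ≡ φ₄ a ⇔ (a + 2) ⊕ (b + 2) ≡ 2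
≡φ₄⇔ {a} {b} a≥30 b≥30 = mk⇔
  -- The truncated subtraction in `a ⊕[ 2 ] 2` is exact because `(a + 2) ⊕ 2` is at least 4.
  (λ b≡ → Equivalence.from xor⇔ (trans (cong (_+ 2) (trans b≡ φ₄-large)) (m∸n+n≡m (≤-trans (m≤n+m 2 2) (4≤⊕ 4≤a+2 2<4)))))
  (λ eq → trans (sym (m+n∸n≡m b 2)) (trans (cong (_∸ 2) (Equivalence.to xor⇔ eq)) (sym φ₄-large)))
  where
  4≤+2 : ∀ {x} → x ≥ 30 → 4 ≤ x + 2
  4≤+2 {x} x≥30 = ≤-trans (≤-trans (m≤m+n 4 26) x≥30) (m≤m+n x 2)
  4≤a+2 = 4≤+2 a≥30
  xor⇔ = ⊕≡2⇔ 4≤a+2 (4≤+2 b≥30)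
  φ₄-large : φ₄ a ≡ a ⊕[ 2 ] 2
  φ₄-large = trans (sym (φ-4 a)) (φ-core 4 a≥30)

theorem28 : ((a b : ℕ) → P-Position (a ∷ b ∷ 4 ∷ []) ⇔ (b ≡ φ₄ a))
    × ((a b : ℕ) → a ≥ 30 → b ≥ 30 → P-Position (a ∷ b ∷ 4 ∷ []) ⇔ ((a + 2) ⊕ (b + 2) ≡ 2))
theorem28 = P⇔φ₄ , λ a b a≥30 b≥30 → ≡φ₄⇔ a≥30 b≥30 ⇔-∘ P⇔φ₄ a b
  where
  P⇔φ₄ : (a b : ℕ) → P-Position (a ∷ b ∷ 4 ∷ []) ⇔ (b ≡ φ₄ a)
  P⇔φ₄ a b = subst (λ z → P-Position (a ∷ b ∷ 4 ∷ []) ⇔ (b ≡ z)) (φ-4 a) (P⇔φ ≤-refl)
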